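{- Let $\alpha\in\mathbb{N}$, let $n\in\mathbb{N}$ with $3\nmid n$ and $n>6\alpha+3$, and let $\mathbb{S}=\langle 6,6\alpha+3,n\rangle$. Then (i) $c(12\alpha+6)=2\alpha+1$; (ii) $c(3n)=\max\left\{2\alpha+1,\ \frac{n-k^*(2\alpha-1)}{2}\right\}$, where $k^*$ is the largest $k\in\mathbb{N}$ with $k\le\frac{n}{2\alpha+1}$ and $2\mid n-k(2\alpha+1)$.
   Context: $\mathbb{N}=\{0,1,2,\dots\}$. For $\mathbb{S}=\langle a_1,a_2,a_3\rangle$ (the $\mathbb{N}$-linear combinations of $a_1,a_2,a_3$) and $a\in\mathbb{S}$, $Z(a)=\{x\in\mathbb{N}^3:x_1a_1+x_2a_2+x_3a_3=a\}$. For $x\in\mathbb{N}^3$, $|x|=x_1+x_2+x_3$; $\gcd\{x,y\}$ is the componentwise minimum; $dist\{x,y\}=\max\{|x-\gcd\{x,y\}|,|y-\gcd\{x,y\}|\}$. An $N$-chain in $Z(a)$ is a sequence of factorizations with consecutive distances $\le N$; $c(a)$ is the least $N\in\mathbb{N}\cup\{\infty\}$ such that any two elements of $Z(a)$ are joined by an $N$-chain.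
   Formalization: The formal theorem assumes α ≥ 1; for α = 0 the statement is false for every admissible n (e.g. S = ⟨6,3,4⟩ has c(6) = 2, not 1, and c(12) = 3, not 4). -}

module Defs where

open import Data.Nat using (ℕ; _≤_; _*_; _∸_; _⊔_; _⊓_)
open import Data.Product using (Σ; _×_; proj₁)
open import Data.Vec using (Vec; sum; zipWith)
open import Function using (flip)
open import Relation.Binary.Core using (Rel)
open import Relation.Binary.Construct.Add.Supremum.NonStrict _≤_ using (_≤⁺_)
open import Relation.Binary.Construct.Closure.ReflexiveTransitive using (Star)
open import Relation.Binary.PropositionalEquality using (_≡_)
open import Relation.Nullary.Construct.Add.Supremum using (_⁺; [_])

IsLeast : {A : Set} → Rel A _ → (A → Set) → A → Set
IsLeast _≼_ P m = P m × (∀ x → P x → m ≼ x)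

IsGreatest : {A : Set} → Rel A _ → (A → Set) → A → Set
IsGreatest _≼_ = IsLeast (flip _≼_)

ℕ³ : Set
ℕ³ = Vec ℕ 3

-- ⊤⁺ plays the role of ∞.
ℕ∞ : Set
ℕ∞ = ℕ ⁺

∣_∣ : ℕ³ → ℕ
∣_∣ = sum

-- Factorizations are written additively, so their gcd is the
-- componentwise minimum.
gcd : ℕ³ → ℕ³ → ℕ³
gcd = zipWith _⊓_

_-_ : ℕ³ → ℕ³ → ℕ³
_-_ = zipWith _∸_

dist : ℕ³ → ℕ³ → ℕ
dist x y = ∣ x - gcd x y ∣ ⊔ ∣ y - gcd x y ∣

-- A semigroup ⟨ g₁ , g₂ , g₃ ⟩ is given by its vector g of generators.
Z : ℕ³ → ℕ → Set
Z g a = Σ ℕ³ λ x → sum (zipWith _*_ x g) ≡ a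

-- a is an ℕ-linear combination of g exactly when it has a factorization.
_∈⟨_⟩ : ℕ → ℕ³ → Set
a ∈⟨ g ⟩ = Z g a

Chain : (g : ℕ³) (a : ℕ) → ℕ∞ → Rel (Z g a) _
Chain g a N = Star λ x y → [ dist (proj₁ x) (proj₁ y) ] ≤⁺ N

AllJoined : ℕ³ → ℕ → ℕ∞ → Set
AllJoined g a N = (x y : Z g a) → Chain g a N x y

-- The graph of the partial function c, which is defined on ⟨ g ⟩ only.
IsCatenaryDegree : ℕ³ → ℕ → ℕ∞ → Set
IsCatenaryDegree g a c = a ∈⟨ g ⟩ × IsLeast _≤⁺_ (AllJoined g a) c

{-# OPTIONS --safe #-}
-- Put m = 2α + 1, so that the generators are 6, 3m and n. Since 3 ∤ n, a
-- factorization (a, b, c) of 3B has c = 3t and 2a + mb + tn = B. As m is odd,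
-- the factorizations with t = 0 form a single line with step (m, -2, 0), whose
-- consecutive points are at distance m, and from the end with a ≥ m every other
-- factorization is at distance at least m. For B = 2m there is nothing else,
-- while for B = n there is one more factorization (0, 0, 3), whose distance to
-- (a, b, 0) is max (3, a + b); this is least at the end b = k* of the line.
module Submission where

open import Defs
open import Data.Nat using (ℕ; zero; suc; _+_; _*_; _∸_; _⊔_; _≤_; _<_; z≤n; s≤s; NonZero; >-nonZero)
open import Data.Nat.DivMod using (_/_; _%_; m≡m%n+[m/n]*n; m*n/n≡m; /-monoˡ-≤)
open import Data.Nat.Divisibility using (_∣_; _∤_; divides; ∣-refl; _∣0; n∣m*n; m∣m*n; ∣1⇒≡1; ∣m∣n⇒∣m+n; ∣m+n∣m⇒∣n)
open import Data.Nat.Primality using (Prime; prime?; prime[2]; euclidsLemma)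
open import Data.Nat.Properties
open import Data.Nat.Tactic.RingSolver using (solve-∀)
open import Data.Product using (∃; ∃₂; _×_; _,_; proj₁; proj₂)
open import Data.Sum using (_⊎_; inj₁; inj₂)
open import Data.Vec using (_∷_; []; sum; zipWith; head)
open import Data.Vec.Properties using (≡-dec; zipWith-comm)
open import Relation.Binary.Construct.Add.Supremum.NonStrict _≤_ using (_≤⁺_; [_]; _≤⊤⁺; ≤⁺-trans)
open import Relation.Binary.Construct.Closure.ReflexiveTransitive using (ε; _◅_; _◅◅_; reverse)
open import Relation.Binary.PropositionalEquality
open import Relation.Nullary using (yes; no; contradiction)
open import Relation.Nullary.Decidable using (from-yes)
open import Relation.Nullary.Construct.Add.Supremum using ([_])

-- Distances and chains of factorizations

dist-sym : ∀ x y → dist x y ≡ dist y x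
dist-sym x y rewrite zipWith-comm ⊓-comm x y =
  ⊔-comm ∣ x - gcd y x ∣ ∣ y - gcd y x ∣

-- Lower bounds by `m` come from the first coordinate alone, since moving along the line changes it
-- by multiples of `m`.
head∸head≤dist : ∀ x y → head x ∸ head y ≤ dist x y
head∸head≤dist (x₁ ∷ _ ∷ _ ∷ []) (y₁ ∷ _ ∷ _ ∷ []) =
  ≤-trans (∸-monoʳ-≤ x₁ (m⊓n≤n x₁ y₁)) (≤-trans (m≤m+n _ _) (m≤m⊔n _ _))

dist-step : ∀ m a b → dist (m + a ∷ b ∷ 0 ∷ []) (a ∷ 2 + b ∷ 0 ∷ []) ≡ m ⊔ 2
dist-step m a b
  rewrite m≥n⇒m⊓n≡n (m≤n+m a m) | m≤n⇒m⊓n≡m (m≤n+m b 2)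
        | m+n∸n≡m m a | m+n∸n≡m 2 b | n∸n≡0 a | n∸n≡0 b | +-identityʳ m = refl

-- Equality proofs in ℕ are unique. This lets chains pass between a factorization and the same
-- vector rebuilt by `onLine`.
Z-≡ : ∀ {g a} {x y : Z g a} → proj₁ x ≡ proj₁ y → x ≡ y
Z-≡ {x = _ , p} {_ , q} refl = cong (_ ,_) (≡-irrelevant p q)

Chain-sym : ∀ {g a N} {x y : Z g a} → Chain g a N x y → Chain g a N y x
Chain-sym {N = N} = reverse λ {x} {y} →
  subst (λ d → [ d ] ≤⁺ N) (dist-sym (proj₁ x) (proj₁ y))

allJoined-via : ∀ {g a N} (h : Z g a) → (∀ x → Chain g a N x h) → AllJoined g a N
allJoined-via h toHub x y = toHub x ◅◅ Chain-sym (toHub y)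

-- A chain between distinct points has a first step that leaves its start.
chain-lower-bound : ∀ {g a D N} {x y : Z g a} → proj₁ x ≢ proj₁ y →
  (∀ z → proj₁ z ≢ proj₁ x → D ≤ dist (proj₁ x) (proj₁ z)) →
  Chain g a N x y → [ D ] ≤⁺ N
chain-lower-bound x≢y far ε = contradiction refl x≢y
chain-lower-bound {x = x} x≢y far (_◅_ {j = z} s c) with ≡-dec _≟_ (proj₁ z) (proj₁ x)
... | no z≢x = ≤⁺-trans ≤-trans [ far z z≢x ] s
... | yes z≡x rewrite Z-≡ {x = z} {x} z≡x = chain-lower-bound x≢y far c

⊔⁺-lub : ∀ {k l N} → [ k ] ≤⁺ N → [ l ] ≤⁺ N → [ k ⊔ l ] ≤⁺ N
⊔⁺-lub [ p ] [ q ] = [ ⊔-lub p q ]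
⊔⁺-lub (_ ≤⊤⁺) _ = _ ≤⊤⁺

-- Parity

2∣n⊎2∣1+n : ∀ n → (2 ∣ n) ⊎ (2 ∣ suc n)
2∣n⊎2∣1+n zero = inj₁ (2 ∣0)
2∣n⊎2∣1+n (suc n) with 2∣n⊎2∣1+n n
... | inj₁ 2∣n = inj₂ (∣m∣n⇒∣m+n ∣-refl 2∣n)
... | inj₂ 2∣1+n = inj₁ 2∣1+n

2∣1+n⇒2∤n : ∀ {n} → 2 ∣ suc n → 2 ∤ n
2∣1+n⇒2∤n {n} 2∣1+n 2∣n =
  contradiction (∣1⇒≡1 (∣m+n∣m⇒∣n (subst (2 ∣_) (+-comm 1 n) 2∣1+n) 2∣n)) λ ()

prime[3] : Prime 3
prime[3] = from-yes (prime? 3)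

-- The equation 2a + mb = B for odd m

module _ (m : ℕ) (odd : 2 ∣ suc m) where

  -- Subtracting the equations gives 2(a - a′) = (b′ - b)m. As `m` is odd, Euclid's lemma forces 2
  -- to divide b′ - b, and `j` is half of it.
  same-line : ∀ {a b a′ b′} → a * 2 + b * m ≡ a′ * 2 + b′ * m → b ≤ b′ →
    ∃ λ j → b′ ≡ j * 2 + b × a ≡ j * m + a′
  same-line {a} {b} {a′} {b′} e b≤b′ with m≤n⇒∃[o]m+o≡n b≤b′
  ... | d , refl with euclidsLemma d m prime[2] 2∣dm
    where
    swap : ∀ a b d m → a * 2 + (b + d) * m ≡ a * 2 + d * m + b * m
    swap = solve-∀
    e′ : a * 2 ≡ a′ * 2 + d * m
    e′ = +-cancelʳ-≡ (b * m) _ _ (trans e (swap a′ b d m))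
    2∣dm : 2 ∣ d * m
    2∣dm = ∣m+n∣m⇒∣n (divides a (sym e′)) (n∣m*n a′)
  ... | inj₂ 2∣m = contradiction 2∣m (2∣1+n⇒2∤n odd)
  ... | inj₁ (divides j refl) = j , +-comm b (j * 2) , *-cancelʳ-≡ a _ 2
    (+-cancelʳ-≡ (b * m) _ _ (trans e (swap a′ b j m)))
    where
    swap : ∀ a b j m → a * 2 + (b + j * 2) * m ≡ (j * m + a) * 2 + b * m
    swap = solve-∀

  -- With q = n / m and r = n % m, the largest k is q if r is even and q - 1 if
  -- r is odd, since then r + m is even.
  ∃-largest : ∀ n .{{_ : NonZero m}} → 3 * m < n → ∃₂ λ a k →
    a * 2 + (2 + k) * m ≡ n ×
    IsGreatest _≤_ (λ k → (k ≤ n / m) × (2 ∣ n ∸ k * m)) (2 + k)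
  ∃-largest n 3m<n = go (n / m) (n % m) 3≤n/m (m≡m%n+[m/n]*n n m) refl
    where
    -- The answer is q or q - 1, so q ≥ 3 makes it at least 2. The line then has a point two below
    -- it in b.
    3≤n/m : 3 ≤ n / m
    3≤n/m = subst (_≤ n / m) (m*n/n≡m 3 m) (/-monoˡ-≤ m (<⇒≤ 3m<n))
    go : ∀ q r → 3 ≤ q → n ≡ r + q * m → n / m ≡ q → ∃₂ λ a k →
      a * 2 + (2 + k) * m ≡ n ×
      IsGreatest _≤_ (λ k → (k ≤ n / m) × (2 ∣ n ∸ k * m)) (2 + k)
    go (suc (suc (suc k))) r (s≤s (s≤s (s≤s z≤n))) e eq with 2∣n⊎2∣1+n r
    ... | inj₁ 2∣r@(divides a refl) = a , suc k , sym e ,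
      (≤-reflexive (sym eq) , subst (2 ∣_) (sym n∸qm) 2∣r) ,
      λ x (x≤ , _) → subst (x ≤_) eq x≤
      where
      n∸qm : n ∸ (3 + k) * m ≡ r
      n∸qm = trans (cong (_∸ (3 + k) * m) e) (m+n∸n≡m r ((3 + k) * m))
    ... | inj₂ 2∣1+r with 2∣r+m
      where
      2∣r+m : 2 ∣ r + m
      2∣r+m = ∣m+n∣m⇒∣n (subst (2 ∣_) (cong suc (+-suc r m)) (∣m∣n⇒∣m+n 2∣1+r odd)) ∣-refl
    ... | divides a r+m≡a*2 = a , k , sym n≡ ,
      (≤-trans (n≤1+n (2 + k)) (≤-reflexive (sym eq)) ,
       divides a (trans (cong (_∸ (2 + k) * m) n≡) (m+n∸n≡m (a * 2) ((2 + k) * m)))) ,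
      greatest
      where
      n≡ : n ≡ a * 2 + (2 + k) * m
      n≡ = trans e (trans (sym (+-assoc r m ((2 + k) * m))) (cong (_+ (2 + k) * m) r+m≡a*2))
      greatest : ∀ x → (x ≤ n / m) × (2 ∣ n ∸ x * m) → x ≤ 2 + k
      greatest x (x≤ , 2∣n∸xm) with m≤n⇒m<n∨m≡n (subst (x ≤_) eq x≤)
      ... | inj₁ x<q = ≤-pred x<q
      ... | inj₂ refl = contradiction
        (subst (2 ∣_) (trans (cong (_∸ x * m) e) (m+n∸n≡m r (x * m))) 2∣n∸xm)
        (2∣1+n⇒2∤n 2∣1+r)

  -- Factorizations of multiples of 3

  module _ (n : ℕ) (3∤n : 3 ∤ n) where

    S : ℕ³
    S = 6 ∷ 3 * m ∷ n ∷ []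

    -- Modulo 3 only `c * n` survives, so 3 divides `c`; the whole equation can then be divided by
    -- 3.
    reduce : ∀ B a b c → sum (zipWith _*_ (a ∷ b ∷ c ∷ []) S) ≡ 3 * B →
      ∃ λ t → c ≡ t * 3 × a * 2 + b * m + t * n ≡ B
    reduce B a b c e with euclidsLemma c n prime[3] 3∣cn
      where
      abstract
        regroup : ∀ a b c m n → a * 6 + (b * (3 * m) + (c * n + 0)) ≡ (a * 2 + b * m) * 3 + c * n
        regroup = solve-∀
      3∣cn : 3 ∣ c * n
      3∣cn = ∣m+n∣m⇒∣n (subst (3 ∣_) (trans (sym e) (regroup a b c m n)) (m∣m*n B)) (n∣m*n (a * 2 + b * m))
    ... | inj₂ 3∣n = contradiction 3∣n 3∤n
    ... | inj₁ (divides t refl) = t , refl , *-cancelˡ-≡ _ _ 3 (trans (sym (regroup a b t m n)) e)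
      where
      abstract
        regroup : ∀ a b t m n → a * 6 + (b * (3 * m) + (t * 3 * n + 0)) ≡ 3 * (a * 2 + b * m + t * n)
        regroup = solve-∀

    onLine : ∀ {B} a b → a * 2 + b * m ≡ B → Z S (3 * B)
    onLine {B} a b e = a ∷ b ∷ 0 ∷ [] , trans (regroup a b m) (cong (3 *_) e)
      where
      abstract
        regroup : ∀ a b m → a * 6 + (b * (3 * m) + 0) ≡ 3 * (a * 2 + b * m)
        regroup = solve-∀

    -- Each of the `j` steps trades m copies of 6 for two copies of 3m, which costs `m ⊔ 2`.
    climb : ∀ {B N a b a′ b′} → m ⊔ 2 ≤ N → ∀ j
      (p : a * 2 + b * m ≡ B) (q : a′ * 2 + b′ * m ≡ B) →
      b′ ≡ j * 2 + b → a ≡ j * m + a′ →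
      Chain S (3 * B) [ N ] (onLine a b p) (onLine a′ b′ q)
    climb m⊔2≤N zero p q refl refl rewrite ≡-irrelevant p q = ε
    climb {B} {N} {b = b} {a′} m⊔2≤N (suc j) p q refl refl =
      [ subst (_≤ N) (sym dist≡) m⊔2≤N ] ◅
      climb m⊔2≤N j p′ q (shift j b) refl
      where
      dist≡ : dist (m + j * m + a′ ∷ b ∷ 0 ∷ []) (j * m + a′ ∷ 2 + b ∷ 0 ∷ []) ≡ m ⊔ 2
      dist≡ rewrite +-assoc m (j * m) a′ = dist-step m (j * m + a′) b
      shift : ∀ j b → (1 + j) * 2 + b ≡ j * 2 + (2 + b)
      shift = solve-∀
      regroup : ∀ a b m j → (j * m + a) * 2 + (2 + b) * m ≡ ((1 + j) * m + a) * 2 + b * m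
      regroup = solve-∀
      p′ : (j * m + a′) * 2 + (2 + b) * m ≡ B
      p′ = trans (regroup a′ b m j) p

    -- By `same-line` the two points are `j` steps apart. Being distinct, they have j ≥ 1, so their
    -- first coordinates differ by at least `m`.
    line-far : ∀ {B a b a′ b′} → m ≤ a →
      a * 2 + b * m ≡ B → a′ * 2 + b′ * m ≡ B →
      (a′ ∷ b′ ∷ 0 ∷ []) ≢ (a ∷ b ∷ 0 ∷ []) →
      m ≤ dist (a ∷ b ∷ 0 ∷ []) (a′ ∷ b′ ∷ 0 ∷ [])
    line-far {a = a} {b} {a′} {b′} m≤a p q ≢ with ≤-total b b′
    ... | inj₁ b≤b′ = up (same-line (trans p (sym q)) b≤b′)
      where
      up : (∃ λ j → b′ ≡ j * 2 + b × a ≡ j * m + a′) → _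
      up (zero , refl , refl) = contradiction refl ≢
      up (suc j , refl , refl) = ≤-trans
        (subst (m ≤_) (sym (m+n∸n≡m (m + j * m) a′)) (m≤m+n m (j * m)))
        (head∸head≤dist (a ∷ b ∷ 0 ∷ []) (a′ ∷ b′ ∷ 0 ∷ []))
    ... | inj₂ b′≤b = down (same-line (trans q (sym p)) b′≤b)
      where
      down : (∃ λ j → b ≡ j * 2 + b′ × a′ ≡ j * m + a) → _
      down (zero , refl , refl) = contradiction refl ≢
      down (suc j , refl , refl) = ≤-trans
        (subst (m ≤_) (sym (m+n∸n≡m (m + j * m) a)) (m≤m+n m (j * m)))
        (subst (a′ ∸ a ≤_) (dist-sym (a′ ∷ b′ ∷ 0 ∷ []) (a ∷ b ∷ 0 ∷ []))
          (head∸head≤dist (a′ ∷ b′ ∷ 0 ∷ []) (a ∷ b ∷ 0 ∷ [])))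

    -- The two catenary degrees

    c[6m] : 3 ≤ m → 3 * m < n → IsCatenaryDegree S (3 * (2 * m)) [ m ]
    c[6m] 3≤m 3m<n = hub , allJoined-via hub toHub , λ N joined →
      chain-lower-bound (λ ()) far (joined start hub)
      where
      m⊔2≤m : m ⊔ 2 ≤ m
      m⊔2≤m = ⊔-lub ≤-refl (≤-trans (n≤1+n 2) 3≤m)
      -- The ends of the line: every point climbs to `hub` = (0, 2, 0), and leaving `start` = (m, 0,
      -- 0) costs at least `m`.
      start hub : Z S (3 * (2 * m))
      start = onLine m 0 (trans (+-identityʳ (m * 2)) (*-comm m 2))
      hub = onLine 0 2 refl
      classify : ∀ a b c → sum (zipWith _*_ (a ∷ b ∷ c ∷ []) S) ≡ 3 * (2 * m) →
        c ≡ 0 × a * 2 + b * m ≡ 2 * m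
      classify a b c e with reduce (2 * m) a b c e
      ... | zero , refl , e′ = refl , trans (sym (+-identityʳ _)) e′
      ... | suc t , refl , e′ = contradiction n≤2m (<⇒≱ (≤-<-trans (*-monoˡ-≤ m (n≤1+n 2)) 3m<n))
        where
        n≤2m : n ≤ 2 * m
        n≤2m = subst (n ≤_) e′ (≤-trans (m≤m+n n (t * n)) (m≤n+m (n + t * n) (a * 2 + b * m)))
      b≤2 : ∀ a b → a * 2 + b * m ≡ 2 * m → b ≤ 2
      b≤2 a b e = *-cancelʳ-≤ b 2 m {{>-nonZero (≤-trans (s≤s z≤n) 3≤m)}}
        (subst (b * m ≤_) e (m≤n+m (b * m) (a * 2)))
      toHub : ∀ x → Chain S (3 * (2 * m)) [ m ] x hub
      toHub x@(a ∷ b ∷ c ∷ [] , e) with classify a b c e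
      ... | refl , e′ with same-line {a} {b} {0} {2} e′ (b≤2 a b e′)
      ... | j , p , q = subst (λ y → Chain S (3 * (2 * m)) [ m ] y hub) (Z-≡ {x = onLine a b e′} {x} refl)
        (climb m⊔2≤m j e′ refl p q)
      far : ∀ z → proj₁ z ≢ proj₁ start → m ≤ dist (proj₁ start) (proj₁ z)
      far (a ∷ b ∷ c ∷ [] , e) ≢ with classify a b c e
      ... | refl , e′ = line-far ≤-refl (trans (+-identityʳ (m * 2)) (*-comm m 2)) e′ ≢

    -- The last hypothesis makes (a*, 2 + k, 0) the top of the line. Writing its second coordinate
    -- as `2 + k` provides the point (m + a*, k, 0) one step before it. Leaving that point costs at
    -- least `m`; leaving (0, 0, 3) costs at least `a* + (2 + k)`.
    c[3n] : 3 ≤ m → ∀ a* k → a* * 2 + (2 + k) * m ≡ n →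
      (∀ a b → a * 2 + b * m ≡ n → b ≤ 2 + k) →
      IsCatenaryDegree S (3 * n) [ m ⊔ (a* + (2 + k)) ]
    c[3n] 3≤m a* k e* top = hub , allJoined-via hub toHub , λ N joined →
      ⊔⁺-lub (chain-lower-bound (λ ()) far-start (joined start isolated))
             (chain-lower-bound (λ ()) far-isolated (joined isolated hub))
      where
      D : ℕ
      D = m ⊔ (a* + (2 + k))
      2≤m : 2 ≤ m
      2≤m = ≤-trans (n≤1+n 2) 3≤m
      e₀ : (m + a*) * 2 + k * m ≡ n
      e₀ = trans (regroup a* k m) e*
        where
        abstract
          regroup : ∀ a k m → (m + a) * 2 + k * m ≡ a * 2 + (2 + k) * m
          regroup = solve-∀
      start hub isolated : Z S (3 * n)
      start = onLine (m + a*) k e₀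
      hub = onLine a* (2 + k) e*
      isolated = 0 ∷ 0 ∷ 3 ∷ [] , +-identityʳ (3 * n)
      n≢0 : n ≢ 0
      n≢0 refl = 3∤n (3 ∣0)
      m≢0 : m ≢ 0
      m≢0 refl = contradiction 3≤m λ ()
      classify : ∀ a b c → sum (zipWith _*_ (a ∷ b ∷ c ∷ []) S) ≡ 3 * n →
        (c ≡ 0 × a * 2 + b * m ≡ n) ⊎ (a ∷ b ∷ c ∷ []) ≡ (0 ∷ 0 ∷ 3 ∷ [])
      classify a b c e with reduce n a b c e
      ... | zero , refl , e′ = inj₁ (refl , trans (sym (+-identityʳ _)) e′)
      ... | suc t , refl , e′ = inj₂ (cong₂ _∷_ a≡0 (cong₂ _∷_ b≡0 (cong (λ s → suc s * 3 ∷ []) t≡0)))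
        where
        shift : ∀ u t n → u + (1 + t) * n ≡ u + t * n + n
        shift = solve-∀
        rest≡0 : a * 2 + b * m + t * n ≡ 0
        rest≡0 = +-cancelʳ-≡ n _ 0 (trans (sym (shift (a * 2 + b * m) t n)) e′)
        line≡0 : a * 2 + b * m ≡ 0
        line≡0 = m+n≡0⇒m≡0 (a * 2 + b * m) rest≡0
        t≡0 : t ≡ 0
        t≡0 with m*n≡0⇒m≡0∨n≡0 t (m+n≡0⇒n≡0 (a * 2 + b * m) rest≡0)
        ... | inj₁ z = z
        ... | inj₂ z = contradiction z n≢0
        a≡0 : a ≡ 0
        a≡0 = m*n≡0⇒m≡0 a 2 (m+n≡0⇒m≡0 (a * 2) line≡0)
        b≡0 : b ≡ 0
        b≡0 with m*n≡0⇒m≡0∨n≡0 b (m+n≡0⇒n≡0 (a * 2) line≡0)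
        ... | inj₁ z = z
        ... | inj₂ z = contradiction z m≢0
      toHub : ∀ x → Chain S (3 * n) [ D ] x hub
      toHub x@(a ∷ b ∷ c ∷ [] , e) with classify a b c e
      -- The distance from (0, 0, 3) to `hub` is the maximum of 3 and `a* + (2 + k)`; the 3 is
      -- absorbed by 3 ≤ m.
      ... | inj₂ refl = [ ⊔-mono-≤ 3≤m
        (≤-reflexive (cong (a* +_) (+-identityʳ (2 + k)))) ] ◅ ε
      ... | inj₁ (refl , e′) with same-line {a} {b} {a*} {2 + k} (trans e′ (sym e*)) (top a b e′)
      ... | j , p , q = subst (λ y → Chain S (3 * n) [ D ] y hub) (Z-≡ {x = onLine a b e′} {x} refl)
        (climb (≤-trans (⊔-lub ≤-refl 2≤m) (m≤m⊔n m _)) j e′ e* p q)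
      far-start : ∀ z → proj₁ z ≢ proj₁ start → m ≤ dist (proj₁ start) (proj₁ z)
      far-start (a ∷ b ∷ c ∷ [] , e) ≢ with classify a b c e
      ... | inj₁ (refl , e′) = line-far (m≤m+n m a*) e₀ e′ ≢
      ... | inj₂ refl = ≤-trans (m≤m+n m a*) (head∸head≤dist (proj₁ start) (0 ∷ 0 ∷ 3 ∷ []))
      far-isolated : ∀ z → proj₁ z ≢ proj₁ isolated →
        a* + (2 + k) ≤ dist (proj₁ isolated) (proj₁ z)
      far-isolated (a ∷ b ∷ c ∷ [] , e) ≢ with classify a b c e
      ... | inj₂ refl = contradiction refl ≢
      ... | inj₁ (refl , e′) with same-line {a} {b} {a*} {2 + k} (trans e′ (sym e*)) (top a b e′)
      -- Each step back from `hub` lowers b by 2 and raises a by m ≥ 2, so a + b is smallest at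
      -- `hub`.
      ... | j , p , refl = begin
        a* + (2 + k)           ≡⟨ cong (a* +_) p ⟩
        a* + (j * 2 + b)       ≡⟨ regroup a* (j * 2) b ⟩
        j * 2 + a* + (b + 0)   ≤⟨ +-monoˡ-≤ (b + 0) (+-monoˡ-≤ a* (*-monoʳ-≤ j 2≤m)) ⟩
        j * m + a* + (b + 0)   ≤⟨ m≤n⊔m 3 _ ⟩
        dist (0 ∷ 0 ∷ 3 ∷ []) (j * m + a* ∷ b ∷ 0 ∷ []) ∎
        where
        open ≤-Reasoning
        regroup : ∀ a u b → a + (u + b) ≡ u + a + (b + 0)
        regroup = solve-∀

-- Translation from m back to α

abstract
  6α+3≡ : ∀ α → 6 * α + 3 ≡ 3 * suc (2 * α)
  6α+3≡ = solve-∀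

  12α+6≡ : ∀ α → 12 * α + 6 ≡ 3 * (2 * suc (2 * α))
  12α+6≡ = solve-∀

2∣2+2α : ∀ α → 2 ∣ 2 + 2 * α
2∣2+2α α = ∣m∣n⇒∣m+n ∣-refl (m∣m*n α)

-- The case α = 0 is excluded: there 6 and 3 + 3 are the two factorizations of 6, at distance 2
-- rather than 1. For natural k the bound by the integer quotient agrees with the rational one, and
-- it keeps `n ∸ k * (2 * α + 1)` free of truncation.
theorem10 : (α n : ℕ) → 1 ≤ α → 3 ∤ n → 6 * α + 3 < n →
    let S = 6 ∷ (6 * α + 3) ∷ n ∷ [] in
    IsCatenaryDegree S (12 * α + 6) [ 2 * α + 1 ]
    ×
    (∃ λ k* →
    IsGreatest _≤_ (λ k → (k ≤ n / suc (2 * α)) × (2 ∣ n ∸ k * (2 * α + 1))) k*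
    ×
    IsCatenaryDegree S (3 * n)
    [ (2 * α + 1) ⊔ ((n ∸ k* * (2 * α ∸ 1)) / 2) ])
theorem10 α n 1≤α 3∤n 3m<n
  rewrite +-comm (2 * α) 1 | 6α+3≡ α | 12α+6≡ α
  with ∃-largest (suc (2 * α)) (2∣2+2α α) n 3m<n
... | a , k , e , greatest = c[6m] m odd n 3∤n 3≤m 3m<n , 2 + k , greatest ,
  subst (λ d → IsCatenaryDegree (S m odd n 3∤n) (3 * n) [ m ⊔ d ]) (sym half≡)
    (c[3n] m odd n 3∤n 3≤m a k e top)
  where
  m : ℕ
  m = suc (2 * α)
  odd : 2 ∣ suc m
  odd = 2∣2+2α α
  3≤m : 3 ≤ m
  3≤m = s≤s (*-monoʳ-≤ 2 1≤α)
  m≡ : m ≡ (2 * α ∸ 1) + 2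
  m≡ = trans (cong suc (sym (m∸n+n≡m {2 * α} {1} (≤-trans 1≤α (m≤m+n α _))))) (sym (+-suc _ 1))
  regroup : ∀ a k p → a * 2 + k * (p + 2) ≡ (a + k) * 2 + k * p
  regroup = solve-∀
  -- Splitting m as (2α - 1) + 2 moves 2k* into the even part of n = 2a + k*m, so the halving below
  -- is exact.
  n≡ : n ≡ (a + (2 + k)) * 2 + (2 + k) * (2 * α ∸ 1)
  n≡ = trans (sym e) (trans (cong (λ m → a * 2 + (2 + k) * m) m≡) (regroup a (2 + k) (2 * α ∸ 1)))
  half≡ : (n ∸ (2 + k) * (2 * α ∸ 1)) / 2 ≡ a + (2 + k)
  half≡ = trans (cong (_/ 2) (trans (cong (_∸ (2 + k) * (2 * α ∸ 1)) n≡) (m+n∸n≡m ((a + (2 + k)) * 2) ((2 + k) * (2 * α ∸ 1)))))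
    (m*n/n≡m (a + (2 + k)) 2)
  -- The second coordinate of any point of the line is itself a candidate for k*.
  top : ∀ a b → a * 2 + b * m ≡ n → b ≤ 2 + k
  top a b e = proj₂ greatest b
    ( subst (_≤ n / m) (m*n/n≡m b m) (/-monoˡ-≤ m (subst (b * m ≤_) e (m≤n+m (b * m) (a * 2))))
    , divides a (trans (cong (_∸ b * m) (sym e)) (m+n∸n≡m (a * 2) (b * m))))
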